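{- Let $p,q$ be consecutive patterns of length 4 satisfying the standing assumptions below, and let $\epsilon\in I_n$ with $T:=\operatorname{Em}(p,\epsilon)$. Consider the following iterative procedure: (a) compute $T=\operatorname{Em}(p,\epsilon)$; (b) change all occurrences of $p$ at positions in $T$ to $q$, and call the resulting sequence $\epsilon'$; (c) let $S=\operatorname{Em}(q,\epsilon')$ and change all occurrences of $q$ at positions in $S\setminus T$ to $p$, calling the result again $\epsilon'$; (d) repeat step (c) until $S\setminus T=\emptyset$, so that $\epsilon'$ has $q$ occurring exactly at the positions in $T$. Then the output $\epsilon'$ of this procedure equals $\phi_{=T}(\epsilon)$, where $\phi_{=T}$ is the recursively defined bijection described below.
   Context: An inversion sequence of length $n$ is an integer sequence $\epsilon_1\cdots\epsilon_n$ with $0\le\epsilon_i<i$; $I_n$ is the set of them. The reduction of an integer word replaces each occurrence of its $k$-th smallest distinct value by $k-1$. A consecutive pattern $p=\underline{p_1p_2p_3p_4}$ occurs in $\epsilon$ at position $i$ if the reduction of $\epsilon_i\cdots\epsilon_{i+3}$ is $p_1p_2p_3p_4$; $\operatorname{Em}(p,\epsilon)$ is the set of such $i$. A pattern is non-overlapping if no two of its occurrences in any sequence overlap in more than one entry. Standing assumptions: $p$ and $q$ are each non-overlapping, agree in their first entries and in their last entries, have the same maximum entry $d$, and each contains every value in $\{0,\dots,d\}$. Change operation: if $p$ occurs at $i$, let $f$ be the order-preserving bijection from $\{0,\dots,d\}$ onto the set of values $\{\epsilon_i,\dots,\epsilon_{i+3}\}$ (so $\epsilon_{i+j-1}=f(p_j)$);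 changing the occurrence to $q$ replaces $\epsilon_{i+j-1}$ by $f(q_j)$, $j=1,\dots,4$ (symmetrically from $q$ to $p$). It is assumed such changes on inversion sequences always yield inversion sequences. Let $I_{n,p}(\supseteq T)=\{\epsilon\in I_n:\operatorname{Em}(p,\epsilon)\supseteq T\}$, $I_{n,p}(=T)=\{\epsilon\in I_n:\operatorname{Em}(p,\epsilon)=T\}$, and similarly for $q$. $\phi_{\ge T}:I_{n,p}(\supseteq T)\to I_{n,q}(\supseteq T)$ changes the occurrences of $p$ at all positions of $T$ to $q$; it is assumed to be a bijection, with inverse $\phi^{ -1}_{\ge T}$ changing the occurrences of $q$ at positions of $T$ to $p$. The maps $\phi_{=T}:I_{n,p}(=T)\to I_{n,q}(=T)$ and $\psi_{=T}=\phi_{=T}^{ -1}$ are defined by mutual recursion: to compute $\phi_{=T}(\epsilon)$, set $\eta:=\phi_{\ge T}(\epsilon)$; then repeatedly let $S:=\operatorname{Em}(q,\eta)$; if $S=T$ output $\eta$, otherwise (then $S\supsetneq T$) replace $\eta$ by $\phi_{\ge T}(\psi_{=S}(\eta))$ and repeat. To compute $\psi_{=T}(\eta)$, set $\epsilon:=\phi^{ -1}_{\ge T}(\eta)$; then repeatedly let $R:=\operatorname{Em}(p,\epsilon)$; if $R=T$ output $\epsilon$, otherwise replace $\epsilon$ by $\phi^{ -1}_{\ge T}(\phi_{=R}(\epsilon))$ and repeat. -}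

module Defs where

open import Data.Bool.Base using (if_then_else_)
open import Data.Fin.Base using (Fin; zero; suc; toℕ; fromℕ)
open import Data.Fin.Subset using (Subset; _∈_; _⊆_; _─_; ⁅_⁆; Empty; Nonempty)
open import Data.List.Base using (List; []; _∷_; take; drop; map; foldr; filter; length; allFin)
open import Data.List.Properties using (≡-dec)
open import Data.Nat.Base using (ℕ; zero; suc; _+_; _≤_; _<_)
open import Data.Nat.Properties using (_≟_; _<?_; <-cmp)
open import Data.Product.Base using (_×_; ∃-syntax)
open import Data.Vec.Base using (Vec; []; _∷_; lookup; tabulate; toList)
open import Relation.Binary.Definitions using (tri<; tri≈; tri>)
open import Relation.Binary.PropositionalEquality using (_≡_; _≢_; refl)
open import Relation.Nullary using (Dec; does; contradiction)

Pattern : Set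
Pattern = Vec ℕ 4

-- Entries and positions are counted from 0, so the usual condition
-- 0 ≤ ε_i < i (i = 1, …, n) reads ε i ≤ i.
Inversion : ∀ {n} → Vec ℕ n → Set
Inversion ε = ∀ i → lookup ε i ≤ toℕ i

insert : ℕ → List ℕ → List ℕ
insert a []       = a ∷ []
insert a (b ∷ bs) with <-cmp a b
... | tri< _ _ _ = a ∷ b ∷ bs
... | tri≈ _ _ _ = b ∷ bs
... | tri> _ _ _ = b ∷ insert a bs

-- The distinct values of a word, in strictly increasing order.
values : List ℕ → List ℕ
values = foldr insert []

-- The k-th smallest distinct value has exactly k - 1 distinct values below it.
reduction : List ℕ → List ℕ
reduction w = map (λ a → length (filter (_<? a) (values w))) w

-- The window is shorter than 4 when i is one of the last three positions; then
-- no pattern occurs at i.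
window : ∀ {n} → Vec ℕ n → Fin n → List ℕ
window ε i = take 4 (drop (toℕ i) (toList ε))

OccursAt : ∀ {n} → Pattern → Vec ℕ n → Fin n → Set
OccursAt p ε i = reduction (window ε i) ≡ toList p

occursAt? : ∀ {n} (p : Pattern) (ε : Vec ℕ n) (i : Fin n) → Dec (OccursAt p ε i)
occursAt? p ε i = ≡-dec _≟_ (reduction (window ε i)) (toList p)

Em : ∀ {n} → Pattern → Vec ℕ n → Subset n
Em p ε = tabulate λ i → does (occursAt? p ε i)

-- Total indexing; the default is never reached for k < length as.
nth : List ℕ → ℕ → ℕ
nth []       _       = 0
nth (a ∷ _)  zero    = a
nth (_ ∷ as) (suc k) = nth as k

overwrite : ∀ {n} → ℕ → List ℕ → Vec ℕ n → Vec ℕ n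
overwrite _       _        []      = []
overwrite (suc k) bs       (a ∷ ε) = a ∷ overwrite k bs ε
overwrite zero    []       (a ∷ ε) = a ∷ ε
overwrite zero    (b ∷ bs) (_ ∷ ε) = b ∷ overwrite zero bs ε

-- Changes, simultaneously, the occurrences at the positions of T to q.  The map
-- nth (values (window ε i)) is the order-preserving bijection f from {0,…,d}
-- onto the values of the window.  It does not depend on which pattern occurs
-- at i, so the same function serves for p-to-q and (with p for q) for q-to-p.
-- Every window is read from the original ε.
change : ∀ {n} → Pattern → Subset n → Vec ℕ n → Vec ℕ n
change {n} q T ε = foldr changeAt ε (allFin n)
  where
  changeAt : Fin n → Vec ℕ n → Vec ℕ n
  changeAt i η =
    if lookup T i
    then overwrite (toℕ i) (map (nth (values (window ε i))) (toList q)) η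
    else η

I⊇ : ∀ {n} → Pattern → Subset n → Vec ℕ n → Set
I⊇ p T ε = Inversion ε × T ⊆ Em p ε

I= : ∀ {n} → Pattern → Subset n → Vec ℕ n → Set
I= p T ε = Inversion ε × Em p ε ≡ T

NonOverlapping : Pattern → Set
NonOverlapping p = ∀ {m} (w : Vec ℕ m) {i j : Fin m} →
  i ∈ Em p w → j ∈ Em p w → toℕ i < toℕ j → toℕ i + 3 ≤ toℕ j

-- The maximum entry is d and every value in {0,…,d} appears.
HasEntries0To : ℕ → Pattern → Set
HasEntries0To d p = (∀ j → lookup p j ≤ d) × (∀ k → k ≤ d → ∃[ j ] lookup p j ≡ k)

ChangePreservesInversion : Pattern → Pattern → Set
ChangePreservesInversion p q = ∀ {n} (ε : Vec ℕ n) (i : Fin n) →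
  Inversion ε → i ∈ Em p ε → Inversion (change q ⁅ i ⁆ ε)

record StandingAssumptions (p q : Pattern) : Set where
  field
    p-nonOverlapping : NonOverlapping p
    q-nonOverlapping : NonOverlapping q
    sameFirst        : lookup p zero ≡ lookup q zero
    sameLast         : lookup p (fromℕ 3) ≡ lookup q (fromℕ 3)
    d                : ℕ
    p-entries        : HasEntries0To d p
    q-entries        : HasEntries0To d q
    p→q-inversion    : ChangePreservesInversion p q
    q→p-inversion    : ChangePreservesInversion q p
    -- φ≥ T = change q T is a bijection I⊇ p T → I⊇ q T with inverse change p T.
    φ≥-to       : ∀ {n} (T : Subset n) ε → I⊇ p T ε → I⊇ q T (change q T ε)
    φ≥-from     : ∀ {n} (T : Subset n) η → I⊇ q T η → I⊇ p T (change p T η)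
    φ≥-inverseˡ : ∀ {n} (T : Subset n) ε → I⊇ p T ε → change p T (change q T ε) ≡ ε
    φ≥-inverseʳ : ∀ {n} (T : Subset n) η → I⊇ q T η → change q T (change p T η) ≡ η

-- Graphs of the mutually recursive maps φ=T and ψ=T: a derivation of
-- φ= p q T ε η is a terminating computation of φ=T on ε with output η, and
-- φ-Loop p q T η η′ is a run of its loop from the current value η.
mutual

  data φ= {n} (p q : Pattern) (T : Subset n) : Vec ℕ n → Vec ℕ n → Set where
    start : ∀ {ε η} → φ-Loop p q T (change q T ε) η → φ= p q T ε η

  data φ-Loop {n} (p q : Pattern) (T : Subset n) : Vec ℕ n → Vec ℕ n → Set where
    stop   : ∀ {η} → Em q η ≡ T → φ-Loop p q T η η
    repeat : ∀ {η ε η′} → Em q η ≢ T →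
             ψ= p q (Em q η) η ε →
             φ-Loop p q T (change q T ε) η′ →
             φ-Loop p q T η η′

  data ψ= {n} (p q : Pattern) (T : Subset n) : Vec ℕ n → Vec ℕ n → Set where
    start : ∀ {η ε} → ψ-Loop p q T (change p T η) ε → ψ= p q T η ε

  data ψ-Loop {n} (p q : Pattern) (T : Subset n) : Vec ℕ n → Vec ℕ n → Set where
    stop   : ∀ {ε} → Em p ε ≡ T → ψ-Loop p q T ε ε
    repeat : ∀ {ε η ε′} → Em p ε ≢ T →
             φ= p q (Em p ε) ε η →
             ψ-Loop p q T (change p T η) ε′ →
             ψ-Loop p q T ε ε′

-- The loop changing the occurrences of q outside T back to p; T stays fixed while
-- the set of occurrences of q is recomputed in each round.
data Iterate {n} (p q : Pattern) (T : Subset n) : Vec ℕ n → Vec ℕ n → Set where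
  stop   : ∀ {ε} → Empty (Em q ε ─ T) → Iterate p q T ε ε
  repeat : ∀ {ε ε′} → Nonempty (Em q ε ─ T) →
           Iterate p q T (change p (Em q ε ─ T) ε) ε′ →
           Iterate p q T ε ε′

Procedure : ∀ {n} → Pattern → Pattern → Vec ℕ n → Vec ℕ n → Set
Procedure p q ε ε′ = let T = Em p ε in Iterate p q T (change q T ε) ε′

-- The graphs are single-valued: each input has at most one output.
module _ {n : ℕ} {p q : Pattern} where
  mutual

    φ=-functional : ∀ {T : Subset n} {ε η η′} → φ= p q T ε η → φ= p q T ε η′ → η ≡ η′
    φ=-functional (start l) (start l′) = φ-Loop-functional l l′

    φ-Loop-functional : ∀ {T : Subset n} {ζ η η′} →
      φ-Loop p q T ζ η → φ-Loop p q T ζ η′ → η ≡ η′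
    φ-Loop-functional (stop _)       (stop _)          = refl
    φ-Loop-functional (stop e)       (repeat e′ _ _)   = contradiction e e′
    φ-Loop-functional (repeat e _ _) (stop e′)         = contradiction e′ e
    φ-Loop-functional (repeat _ s l) (repeat _ s′ l′) with refl ← ψ=-functional s s′ =
      φ-Loop-functional l l′

    ψ=-functional : ∀ {T : Subset n} {η ε ε′} → ψ= p q T η ε → ψ= p q T η ε′ → ε ≡ ε′
    ψ=-functional (start l) (start l′) = ψ-Loop-functional l l′

    ψ-Loop-functional : ∀ {T : Subset n} {ζ ε ε′} →
      ψ-Loop p q T ζ ε → ψ-Loop p q T ζ ε′ → ε ≡ ε′
    ψ-Loop-functional (stop _)       (stop _)          = refl
    ψ-Loop-functional (stop e)       (repeat e′ _ _)   = contradiction e e′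
    ψ-Loop-functional (repeat e _ _) (stop e′)         = contradiction e′ e
    ψ-Loop-functional (repeat _ s l) (repeat _ s′ l′) with refl ← φ=-functional s s′ =
      ψ-Loop-functional l l′

  Iterate-functional : ∀ {T : Subset n} {ζ ε ε′} →
    Iterate p q T ζ ε → Iterate p q T ζ ε′ → ε ≡ ε′
  Iterate-functional (stop _)     (stop _)      = refl
  Iterate-functional (stop e)     (repeat s _)  = contradiction s e
  Iterate-functional (repeat s _) (stop e)      = contradiction s e
  Iterate-functional (repeat _ l) (repeat _ l′) = Iterate-functional l l′

{-# OPTIONS --safe #-}

-- Non-overlap makes the changes available at one time independent: for disjoint
-- U, V ⊆ Em q x, changing U keeps the occurrences at V, and changing U and then V
-- is changing U ∪ V.  So the procedure, which changes everything outside T in each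
-- round, is the maximal strategy of a rewriting system with the diamond property,
-- and its outcome is the same for any two words joined by changes outside T.
-- A round x ↦ change q T (ψ=S x), S = Em q x, of the loop of φ=T is such a zigzag
-- of changes, because by induction ψ=S is the reversed procedure for the larger set
-- S; hence the loop and the procedure can only end in the same word.  The loop does
-- end: its rounds are injective and no round leads back to the starting point
-- (Garsia–Milne), so its orbit in the finite set I_n has no repetition.  Its end
-- is an end of the procedure too, so the latter needs no termination argument.
module Submission where

open import Defs
open import Data.Bool.Base using (true; false; if_then_else_)
open import Data.Bool.Properties as Bool using ()
open import Data.Fin.Base using (Fin; zero; suc; toℕ; fromℕ<; funToFin; finToFun)
open import Data.Fin.Properties
  using (any?; toℕ-injective; toℕ<n; pigeonhole; finToFun-funToFin; fromℕ<-injective)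
open import Data.Fin.Subset using (Subset; _∈_; _∉_; _⊆_; _⊂_; _⊃_; _∪_; _─_; Empty)
open import Data.Fin.Subset.Induction using (Acc; acc; ⊃-wellFounded)
open import Data.Fin.Subset.Properties
  using (_∈?_; x∈p∪q⁻; p⊆p∪q; q⊆p∪q; p─q⊆p; x∈p∧x∉q⇒x∈p─q; ⊆-antisym; ∪-comm; nonempty?)
open import Data.List.Base using (List; []; _∷_; take; drop; map; foldr; filter; length; allFin)
open import Data.List.Membership.Propositional using () renaming (_∈_ to _∈ₗ_)
open import Data.List.Membership.Propositional.Properties using (∈-allFin)
open import Data.List.Properties using (filter-none; filter-accept; filter-reject; length-map)
open import Data.List.Relation.Unary.All as All using (All; []; _∷_)
open import Data.List.Relation.Unary.AllPairs using (AllPairs; []; _∷_)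
open import Data.List.Relation.Unary.Any using (here; there)
open import Data.Nat.Base using (ℕ; zero; suc; _+_; _∸_; _^_; _≤_; _<_; z≤n; s≤s; z<s; s<s; s<s⁻¹)
open import Data.Nat.Properties
open import Data.Product.Base using (_×_; _,_; proj₁; proj₂; ∃-syntax)
open import Data.Sum.Base using (_⊎_; inj₁; inj₂; [_,_])
open import Data.Vec.Base using (Vec; []; _∷_; here; there; lookup; toList)
open import Data.Vec.Properties using (lookup∘tabulate; []=⇒lookup; lookup⇒[]=; length-toList; ≡-dec)
open import Function.Base using (_∘_; id; case_of_)
open import Relation.Binary.Definitions using (tri<; tri≈; tri>)
open import Relation.Binary.PropositionalEquality hiding ([_])
open import Relation.Nullary using (¬_; Dec; yes; no; does; contradiction)
open import Relation.Nullary.Decidable using (_×-dec_; dec-true)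

-- Sorted distinct values and ranks.

insert-All : ∀ {P : ℕ → Set} a {bs} → P a → All P bs → All P (insert a bs)
insert-All a pa []                  = pa ∷ []
insert-All a {b ∷ bs} pa (pb ∷ pbs) with <-cmp a b
... | tri< _ _ _ = pa ∷ pb ∷ pbs
... | tri≈ _ _ _ = pb ∷ pbs
... | tri> _ _ _ = pb ∷ insert-All a pa pbs

insert-sorted : ∀ a {bs} → AllPairs _<_ bs → AllPairs _<_ (insert a bs)
insert-sorted a []                  = [] ∷ []
insert-sorted a {b ∷ bs} (b< ∷ bs↗) with <-cmp a b
... | tri< a<b _ _ = (a<b ∷ All.map (<-trans a<b) b<) ∷ b< ∷ bs↗
... | tri≈ _ _ _   = b< ∷ bs↗
... | tri> _ _ b<a = insert-All a b<a b< ∷ insert-sorted a bs↗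

values-sorted : ∀ w → AllPairs _<_ (values w)
values-sorted []      = []
values-sorted (a ∷ w) = insert-sorted a (values-sorted w)

∈-insert-head : ∀ a bs → a ∈ₗ insert a bs
∈-insert-head a []       = here refl
∈-insert-head a (b ∷ bs) with <-cmp a b
... | tri< _ _ _   = here refl
... | tri≈ _ a≡b _ = here a≡b
... | tri> _ _ _   = there (∈-insert-head a bs)

∈-insert-tail : ∀ a {b bs} → b ∈ₗ bs → b ∈ₗ insert a bs
∈-insert-tail a {bs = c ∷ cs} b∈ with <-cmp a c | b∈
... | tri< _ _ _ | _        = there b∈
... | tri≈ _ _ _ | _        = b∈
... | tri> _ _ _ | here e   = here e
... | tri> _ _ _ | there b∈′ = there (∈-insert-tail a b∈′)

nth∈values : ∀ w c → c < length w → nth w c ∈ₗ values w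
nth∈values (a ∷ w) zero    _   = ∈-insert-head a (values w)
nth∈values (a ∷ w) (suc c) c<l = ∈-insert-tail a (nth∈values w c (s<s⁻¹ c<l))

-- In a strictly increasing list the entries below `a` are exactly those in front of it, so their
-- number is the index of `a`.
nth-rank : ∀ {a xs} → AllPairs _<_ xs → a ∈ₗ xs → nth xs (length (filter (_<? a) xs)) ≡ a
nth-rank {a} {x ∷ xs} (x< ∷ _) (here refl)
  rewrite filter-reject (_<? a) {xs = xs} (<-irrefl {x = a} refl)
        | filter-none (_<? a) {xs = xs} (All.map (λ a<y y<a → <-asym a<y y<a) x<) = refl
nth-rank {a} {x ∷ xs} (x< ∷ xs↗) (there a∈)
  rewrite filter-accept (_<? a) {xs = xs} (All.lookup x< a∈) = nth-rank xs↗ a∈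

nth-map : ∀ (f : ℕ → ℕ) as c → c < length as → nth (map f as) c ≡ f (nth as c)
nth-map f (a ∷ as) zero    _   = refl
nth-map f (a ∷ as) (suc c) c<l = nth-map f as c (s<s⁻¹ c<l)

-- This is the identity `ε_{i+j-1} = f(p_j)`: `reduction` gives each entry its rank, and
-- `nth (values w)`, the map `f` of the change operation, undoes that.
nth-values-reduction : ∀ w c → c < length w → nth (values w) (nth (reduction w) c) ≡ nth w c
nth-values-reduction w c c<l
  rewrite nth-map (λ a → length (filter (_<? a) (values w))) w c c<l
  = nth-rank (values-sorted w) (nth∈values w c c<l)

-- Windows and overwritten words, entry by entry.

nth-ext : ∀ as bs → length as ≡ length bs → (∀ c → c < length as → nth as c ≡ nth bs c) → as ≡ bs
nth-ext []       []       _ _ = refl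
nth-ext (a ∷ as) (b ∷ bs) l e =
  cong₂ _∷_ (e 0 z<s) (nth-ext as bs (suc-injective l) (λ c → e (suc c) ∘ s<s))

nth-drop : ∀ i as c → nth (drop i as) c ≡ nth as (i + c)
nth-drop zero    as       c = refl
nth-drop (suc i) []       c = refl
nth-drop (suc i) (a ∷ as) c = nth-drop i as c

nth-take : ∀ {m} as c → c < m → nth (take m as) c ≡ nth as c
nth-take {suc m} []       c       _   = refl
nth-take {suc m} (a ∷ as) zero    _   = refl
nth-take {suc m} (a ∷ as) (suc c) c<m = nth-take as c (s<s⁻¹ c<m)

length-take-drop : ∀ {as bs : List ℕ} m i → length as ≡ length bs →
  length (take m (drop i as)) ≡ length (take m (drop i bs))
length-take-drop zero    i       l = refl
length-take-drop {[]}     {[]}     (suc m) i       l = refl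
length-take-drop {a ∷ as} {b ∷ bs} (suc m) zero    l = cong suc (length-take-drop {as} {bs} m zero (suc-injective l))
length-take-drop {a ∷ as} {b ∷ bs} (suc m) (suc i) l = length-take-drop {as} {bs} (suc m) i (suc-injective l)

length-take≤ : ∀ m (as : List ℕ) → length (take m as) ≤ m
length-take≤ zero    as       = z≤n
length-take≤ (suc m) []       = z≤n
length-take≤ (suc m) (a ∷ as) = s≤s (length-take≤ m as)

at : ∀ {n} → Vec ℕ n → ℕ → ℕ
at x = nth (toList x)

at-ext : ∀ {n} (x y : Vec ℕ n) → (∀ k → k < n → at x k ≡ at y k) → x ≡ y
at-ext []      []      _ = refl
at-ext (a ∷ x) (b ∷ y) e = cong₂ _∷_ (e 0 z<s) (at-ext x y (λ k → e (suc k) ∘ s<s))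

at≥ : ∀ {n} (x : Vec ℕ n) k → n ≤ k → at x k ≡ 0
at≥ []      k       _   = refl
at≥ (a ∷ x) (suc k) n≤k = at≥ x k (≤-pred n≤k)

at-window : ∀ {n} (x : Vec ℕ n) i c → c < 4 → nth (window x i) c ≡ at x (toℕ i + c)
at-window x i c c<4 =
  trans (nth-take (drop (toℕ i) (toList x)) c c<4) (nth-drop (toℕ i) (toList x) c)

window-cong : ∀ {n} (x y : Vec ℕ n) i →
  (∀ c → c < 4 → at x (toℕ i + c) ≡ at y (toℕ i + c)) → window x i ≡ window y i
window-cong x y i e = nth-ext (window x i) (window y i)
  (length-take-drop {toList x} {toList y} 4 (toℕ i) (trans (length-toList x) (sym (length-toList y))))
  λ c c<l → let c<4 = <-≤-trans c<l (length-take≤ 4 (drop (toℕ i) (toList x))) in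
    trans (at-window x i c c<4) (trans (e c c<4) (sym (at-window y i c c<4)))

at-overwrite-in : ∀ {n} (x : Vec ℕ n) m bs k → m ≤ k → k ∸ m < length bs → k < n →
  at (overwrite m bs x) k ≡ nth bs (k ∸ m)
at-overwrite-in (a ∷ x) zero    (b ∷ bs) zero    _   _   _   = refl
at-overwrite-in (a ∷ x) zero    (b ∷ bs) (suc k) _   k<l k<n =
  at-overwrite-in x zero bs k z≤n (s<s⁻¹ k<l) (s<s⁻¹ k<n)
at-overwrite-in (a ∷ x) (suc m) bs       (suc k) m≤k k<l k<n =
  at-overwrite-in x m bs k (≤-pred m≤k) k<l (s<s⁻¹ k<n)

at-overwrite-out : ∀ {n} (x : Vec ℕ n) m bs k → k < m ⊎ m + length bs ≤ k →
  at (overwrite m bs x) k ≡ at x k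
at-overwrite-out []      m       bs       k       _ = refl
at-overwrite-out (a ∷ x) zero    []       k       _ = refl
at-overwrite-out (a ∷ x) zero    (b ∷ bs) (suc k) (inj₂ l) =
  at-overwrite-out x zero bs k (inj₂ (≤-pred l))
at-overwrite-out (a ∷ x) (suc m) bs       zero    _ = refl
at-overwrite-out (a ∷ x) (suc m) bs       (suc k) (inj₁ l) =
  at-overwrite-out x m bs k (inj₁ (s<s⁻¹ l))
at-overwrite-out (a ∷ x) (suc m) bs       (suc k) (inj₂ l) =
  at-overwrite-out x m bs k (inj₂ (≤-pred l))

-- Occurrences, and the entries of a changed word.

foldr-keeps : ∀ {A B : Set} (f : A → B → B) (P : B → Set) →
  (∀ i {b} → P b → P (f i b)) → ∀ {b} → P b → ∀ as → P (foldr f b as)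
foldr-keeps f P keep Pb []       = Pb
foldr-keeps f P keep Pb (i ∷ as) = keep i (foldr-keeps f P keep Pb as)

-- The step at `i` establishes `P` from any state and all later steps preserve it, so the place of
-- `i` in the order of writing does not matter.
foldr-writes : ∀ {A B : Set} (f : A → B → B) (P : B → Set) →
  (∀ i {b} → P b → P (f i b)) → ∀ {i} → (∀ b → P (f i b)) →
  ∀ {b as} → i ∈ₗ as → P (foldr f b as)
foldr-writes f P pres est (here refl) = est _
foldr-writes f P pres est (there i∈)  = pres _ (foldr-writes f P pres est i∈)

nth-first : (p : Pattern) → nth (toList p) 0 ≡ lookup p zero
nth-first (_ ∷ _) = refl

nth-last : (p : Pattern) → nth (toList p) 3 ≡ lookup p (suc (suc (suc zero)))
nth-last (_ ∷ _ ∷ _ ∷ _ ∷ []) = refl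

module _ {n : ℕ} {q : Pattern} {x : Vec ℕ n} {i : Fin n} where

  ∈Em⇒OccursAt : i ∈ Em q x → OccursAt q x i
  ∈Em⇒OccursAt i∈ with occursAt? q x i
                     | trans (sym (lookup∘tabulate (λ j → does (occursAt? q x j)) i)) ([]=⇒lookup i∈)
  ... | yes o | _ = o

  OccursAt⇒∈Em : OccursAt q x i → i ∈ Em q x
  OccursAt⇒∈Em o = lookup⇒[]= i _
    (trans (lookup∘tabulate (λ j → does (occursAt? q x j)) i) (dec-true (occursAt? q x i) o))

-- The value that the change at `i` puts at position `k`; meaningful only if the window at `i`
-- covers `k`, since the subtraction is truncated.
written : ∀ {n} → Pattern → Vec ℕ n → Fin n → ℕ → ℕ
written p x i k = nth (values (window x i)) (nth (toList p) (k ∸ toℕ i))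

-- `Inside` singles out the two middle positions of a window, the only ones where patterns with
-- equal ends can differ.
Covers Inside : ∀ {n} → Fin n → ℕ → Set
Covers i k = toℕ i ≤ k × k < toℕ i + 4
Inside i k = toℕ i < k × k < toℕ i + 3

Covers? : ∀ {n} (i : Fin n) k → Dec (Covers i k)
Covers? i k = (toℕ i ≤? k) ×-dec (k <? toℕ i + 4)

Inside? : ∀ {n} (i : Fin n) k → Dec (Inside i k)
Inside? i k = (toℕ i <? k) ×-dec (k <? toℕ i + 3)

Inside⇒Covers : ∀ {n} {i : Fin n} {k} → Inside i k → Covers i k
Inside⇒Covers {i = i} (i<k , k<) = <⇒≤ i<k , <-≤-trans k< (+-monoʳ-≤ (toℕ i) (n≤1+n 3))

offset<4 : ∀ {n} (i : Fin n) {k} → Covers i k → k ∸ toℕ i < 4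
offset<4 i {k} (i≤k , k<) = +-cancelˡ-< (toℕ i) (k ∸ toℕ i) 4 (subst (_< toℕ i + 4) (sym (m+[n∸m]≡n i≤k)) k<)

length-pattern : (p : Pattern) → length (toList p) ≡ 4
length-pattern = length-toList

module _ {n : ℕ} {q : Pattern} {x : Vec ℕ n} {i : Fin n} (occ : OccursAt q x i) where

  length-window : length (window x i) ≡ 4
  length-window = trans (sym (length-map _ (window x i))) (trans (cong length occ) (length-pattern q))

  written-self : ∀ {k} → Covers i k → written q x i k ≡ at x k
  written-self {k} cov@(i≤k , _) = begin
    nth (values w) (nth (toList q) c)    ≡⟨ cong (λ l → nth (values w) (nth l c)) occ ⟨
    nth (values w) (nth (reduction w) c) ≡⟨ nth-values-reduction w c (subst (c <_) (sym length-window) c<4) ⟩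
    nth w c                              ≡⟨ at-window x i c c<4 ⟩
    at x (toℕ i + c)                     ≡⟨ cong (at x) (m+[n∸m]≡n i≤k) ⟩
    at x k                               ∎
    where
    open ≡-Reasoning
    w = window x i
    c = k ∸ toℕ i
    c<4 = offset<4 i cov

module _ {n : ℕ} (p : Pattern) (U : Subset n) (x : Vec ℕ n) where

  module _ {k} (k<n : k < n) (v : ℕ) (agree : ∀ i → i ∈ U → Covers i k → written p x i k ≡ v) where

    private
      new : Fin n → List ℕ
      new i = map (nth (values (window x i))) (toList p)

      length-new : ∀ i → length (new i) ≡ 4
      length-new i = trans (length-map _ (toList p)) (length-pattern p)

      at-covered : ∀ i (y : Vec ℕ n) → Covers i k → at (overwrite (toℕ i) (new i) y) k ≡ written p x i k
      at-covered i y cov@(i≤k , _) = trans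
        (at-overwrite-in y (toℕ i) (new i) k i≤k (subst (k ∸ toℕ i <_) (sym (length-new i)) (offset<4 i cov)) k<n)
        (nth-map _ (toList p) (k ∸ toℕ i) (subst (k ∸ toℕ i <_) (sym (length-pattern p)) (offset<4 i cov)))

      at-uncovered : ∀ i (y : Vec ℕ n) → ¬ Covers i k → at (overwrite (toℕ i) (new i) y) k ≡ at y k
      at-uncovered i y ¬cov = at-overwrite-out y (toℕ i) (new i) k side
        where
        side : k < toℕ i ⊎ toℕ i + length (new i) ≤ k
        side with toℕ i ≤? k
        ... | no  i≰k = inj₁ (≰⇒> i≰k)
        ... | yes i≤k = inj₂ (subst (λ l → toℕ i + l ≤ k) (sym (length-new i)) (≮⇒≥ (¬cov ∘ (i≤k ,_))))

      preserve : ∀ i {y : Vec ℕ n} → at y k ≡ v →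
        at (if lookup U i then overwrite (toℕ i) (new i) y else y) k ≡ v
      preserve i {y} e with lookup U i in eq
      ... | false = e
      ... | true with Covers? i k
      ... | yes cov = trans (at-covered i y cov) (agree i (lookup⇒[]= i U eq) cov)
      ... | no ¬cov = trans (at-uncovered i y ¬cov) e

      establish : ∀ i → i ∈ U → Covers i k → ∀ (y : Vec ℕ n) →
        at (if lookup U i then overwrite (toℕ i) (new i) y else y) k ≡ v
      establish i i∈ cov y rewrite []=⇒lookup i∈ = trans (at-covered i y cov) (agree i i∈ cov)

    -- Windows sharing an endpoint may write the same position more than once. By `agree` each such
    -- write puts `v` there, and all others leave `k` alone.
    at-change-unwritten : at x k ≡ v → at (change p U x) k ≡ v
    at-change-unwritten e = foldr-keeps _ (λ y → at y k ≡ v) preserve e (allFin n)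

    at-change-written : ∀ i → i ∈ U → Covers i k → at (change p U x) k ≡ v
    at-change-written i i∈ cov =
      foldr-writes _ (λ y → at y k ≡ v) preserve (establish i i∈ cov) (∈-allFin i)

-- Independence of non-overlapping changes.

record Compatible (p q : Pattern) : Set where
  field
    nonOverlapping : NonOverlapping q
    sameFirst      : nth (toList p) 0 ≡ nth (toList q) 0
    sameLast       : nth (toList p) 3 ≡ nth (toList q) 3

module _ {p q : Pattern} (comp : Compatible p q) {n : ℕ} where
  open Compatible comp

  -- At its two ends `p` has the same entries as `q`, and writing `q` over an occurrence of `q`
  -- reproduces the word.
  written-endpoint : ∀ {x : Vec ℕ n} {i k} → i ∈ Em q x → Covers i k → ¬ Inside i k →
    written p x i k ≡ at x k
  written-endpoint {x} {i} {k} i∈ cov@(i≤k , k<) ¬ins =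
    trans (cong (nth (values (window x i))) same) (written-self {q = q} (∈Em⇒OccursAt {q = q} {x} i∈) cov)
    where
    same : nth (toList p) (k ∸ toℕ i) ≡ nth (toList q) (k ∸ toℕ i)
    same with m≤n⇒m<n∨m≡n i≤k
    ... | inj₂ i≡k rewrite sym i≡k | n∸n≡0 (toℕ i) = sameFirst
    -- A covered position after `i` that is not inside must be the last one, `i + 3`.
    ... | inj₁ i<k rewrite ≤-antisym (≤-pred (subst (k <_) (+-suc (toℕ i) 3) k<)) (≮⇒≥ (¬ins ∘ (i<k ,_)))
                         | m+n∸m≡n (toℕ i) 3 = sameLast

  -- Occurrences start at least three apart, so two windows share at most an entry that is last in
  -- one and first in the other.
  Inside-unique : ∀ {x : Vec ℕ n} {i j k} → i ∈ Em q x → j ∈ Em q x → Inside i k → Covers j k → i ≡ j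
  Inside-unique {x} {i} {j} {k} i∈ j∈ (i<k , k<) (j≤k , k<′) with <-cmp (toℕ i) (toℕ j)
  ... | tri≈ _ e _   = toℕ-injective e
  ... | tri< i<j _ _ = contradiction (<-≤-trans k< (≤-trans (nonOverlapping x i∈ j∈ i<j) j≤k)) (<-irrefl refl)
  ... | tri> _ _ j<i = contradiction
    (<-≤-trans k<′ (subst (_≤ k) (sym (+-suc (toℕ j) 3)) (≤-trans (s≤s (nonOverlapping x j∈ i∈ j<i)) i<k)))
    (<-irrefl refl)

  module _ (x : Vec ℕ n) {U : Subset n} (U⊆ : U ⊆ Em q x) where

    at-change-inside : ∀ {i k} → k < n → i ∈ U → Inside i k → at (change p U x) k ≡ written p x i k
    at-change-inside {i} {k} k<n i∈ ins =
      at-change-written p U x k<n (written p x i k) agree i i∈ (Inside⇒Covers {i = i} ins)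
      where
      agree : ∀ j → j ∈ U → Covers j k → written p x j k ≡ written p x i k
      agree j j∈ cov rewrite Inside-unique {x} (U⊆ i∈) (U⊆ j∈) ins cov = refl

    at-change-outside : ∀ {k} → k < n → (∀ i → i ∈ U → ¬ Inside i k) → at (change p U x) k ≡ at x k
    at-change-outside {k} k<n out =
      at-change-unwritten p U x k<n (at x k) (λ i i∈ cov → written-endpoint {x} (U⊆ i∈) cov (out i i∈)) refl

    -- The changed windows meet the window at `j` only in their endpoints, where the old entry is
    -- written back.
    window-change : ∀ {j} → j ∈ Em q x → j ∉ U → window (change p U x) j ≡ window x j
    window-change {j} j∈ j∉ = window-cong (change p U x) x j same
      where
      same : ∀ c → c < 4 → at (change p U x) (toℕ j + c) ≡ at x (toℕ j + c)
      same c c<4 with toℕ j + c <? n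
      -- Past the end of the word both sides read the default 0.
      ... | no  k≮n = trans (at≥ (change p U x) _ (≮⇒≥ k≮n)) (sym (at≥ x _ (≮⇒≥ k≮n)))
      ... | yes k<n = at-change-outside k<n λ i i∈ ins → j∉
        (subst (_∈ U) (Inside-unique {x} (U⊆ i∈) j∈ ins (m≤m+n (toℕ j) c , +-monoʳ-< (toℕ j) c<4)) i∈)

    change-keeps : ∀ {j} → j ∈ Em q x → j ∉ U → j ∈ Em q (change p U x)
    change-keeps j∈ j∉ = OccursAt⇒∈Em {q = q} {change p U x}
      (trans (cong reduction (window-change j∈ j∉)) (∈Em⇒OccursAt {q = q} {x} j∈))

  change-change : ∀ (x : Vec ℕ n) {U V} → U ⊆ Em q x → V ⊆ Em q x → (∀ {i} → i ∈ V → i ∉ U) →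
    change p V (change p U x) ≡ change p (U ∪ V) x
  change-change x {U} {V} U⊆ V⊆ V∩U = at-ext _ _ pointwise
    where
    y = change p U x

    V⊆y : V ⊆ Em q y
    V⊆y i∈ = change-keeps x U⊆ (V⊆ i∈) (V∩U i∈)

    ∪⊆ : U ∪ V ⊆ Em q x
    ∪⊆ = [ U⊆ , V⊆ ] ∘ x∈p∪q⁻ U V

    pointwise : ∀ k → k < n → at (change p V y) k ≡ at (change p (U ∪ V) x) k
    pointwise k k<n with any? (λ i → (i ∈? (U ∪ V)) ×-dec Inside? i k)
    -- A position inside no changed window keeps its entry on both sides; otherwise a single
    -- occurrence determines the new one.
    ... | no none = trans
      (at-change-outside y V⊆y k<n λ i i∈ ins → none (i , q⊆p∪q U V i∈ , ins)) (trans
      (at-change-outside x U⊆ k<n λ i i∈ ins → none (i , p⊆p∪q V i∈ , ins))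
      (sym (at-change-outside x ∪⊆ k<n λ i i∈ ins → none (i , i∈ , ins))))
    ... | yes (i , i∈ , ins) = trans (side (x∈p∪q⁻ U V i∈)) (sym (at-change-inside x ∪⊆ k<n i∈ ins))
      where
      side : i ∈ U ⊎ i ∈ V → at (change p V y) k ≡ written p x i k
      side (inj₁ i∈U) = trans
        (at-change-outside y V⊆y k<n λ j j∈ ins′ →
          V∩U j∈ (subst (_∈ U) (Inside-unique {x} (U⊆ i∈U) (V⊆ j∈) ins (Inside⇒Covers {i = j} ins′)) i∈U))
        (at-change-inside x U⊆ k<n i∈U ins)
      side (inj₂ i∈V) = trans (at-change-inside y V⊆y k<n i∈V ins)
        -- The second change reads its values from `y`, whose window at `i` is still that of `x`.
        (cong (λ w → nth (values w) (nth (toList p) (k ∸ toℕ i))) (window-change x U⊆ (V⊆ i∈V) (V∩U i∈V)))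

change-empty : ∀ {n} (p : Pattern) {U : Subset n} x → Empty U → change p U x ≡ x
change-empty p {U} x empty = at-ext _ _ λ k k<n →
  at-change-unwritten p U x k<n (at x k) (λ i i∈ → contradiction (i , i∈) empty) refl

-- Differences of subsets.

x∈p─q⇒x∉q : ∀ {n} (U V : Subset n) {i} → i ∈ U ─ V → i ∉ V
x∈p─q⇒x∉q (_ ∷ U) (true ∷ V)  (there i∈) (there i∈V) = x∈p─q⇒x∉q U V i∈ i∈V
x∈p─q⇒x∉q (_ ∷ U) (false ∷ V) (there i∈) (there i∈V) = x∈p─q⇒x∉q U V i∈ i∈V

∪-─ : ∀ {n} {U W : Subset n} → U ⊆ W → U ∪ (W ─ U) ≡ W
∪-─ {U = U} {W} U⊆W = ⊆-antisym
  ([ U⊆W , p─q⊆p W U ] ∘ x∈p∪q⁻ U (W ─ U))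
  (λ {i} i∈ → case i ∈? U of λ where
    (yes i∈U) → p⊆p∪q (W ─ U) i∈U
    (no  i∉U) → q⊆p∪q U (W ─ U) (x∈p∧x∉q⇒x∈p─q i∈ i∉U))

⊆-Empty-─ : ∀ {n} (U V : Subset n) → Empty (U ─ V) → U ⊆ V
⊆-Empty-─ U V empty {i} i∈ = case i ∈? V of λ where
  (yes i∈V) → i∈V
  (no  i∉V) → contradiction (i , x∈p∧x∉q⇒x∈p─q i∈ i∉V) empty

⊆∧≢⇒⊂ : ∀ {n} {U V : Subset n} → U ⊆ V → V ≢ U → U ⊂ V
⊆∧≢⇒⊂ {U = U} {V} U⊆V V≢U with nonempty? (V ─ U)
... | yes (i , i∈) = U⊆V , i , p─q⊆p V U i∈ , x∈p─q⇒x∉q V U i∈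
... | no empty     = contradiction (⊆-antisym (⊆-Empty-─ V U empty) U⊆V) V≢U

-- Confluence of changes outside `T`.

module _ {p q : Pattern} (comp : Compatible p q) {n : ℕ} where

  change-rest : ∀ (x : Vec ℕ n) {U W} → U ⊆ W → W ⊆ Em q x →
    change p (W ─ U) (change p U x) ≡ change p W x
  change-rest x {U} {W} U⊆W W⊆ = trans
    (change-change comp x (W⊆ ∘ U⊆W) (W⊆ ∘ p─q⊆p W U) (x∈p─q⇒x∉q W U))
    (cong (λ V → change p V x) (∪-─ U⊆W))

  change-comm : ∀ (x : Vec ℕ n) {U V} → U ⊆ Em q x → V ⊆ Em q x → (∀ {i} → i ∈ V → i ∉ U) →
    change p V (change p U x) ≡ change p U (change p V x)
  change-comm x {U} {V} U⊆ V⊆ V∩U = begin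
    change p V (change p U x) ≡⟨ change-change comp x U⊆ V⊆ V∩U ⟩
    change p (U ∪ V) x        ≡⟨ cong (λ W → change p W x) (∪-comm U V) ⟩
    change p (V ∪ U) x        ≡⟨ change-change comp x V⊆ U⊆ (λ i∈U i∈V → V∩U i∈V i∈U) ⟨
    change p U (change p V x) ∎
    where open ≡-Reasoning

  module _ (T : Subset n) where

    -- A parallel rewriting step: `U` may be any set of occurrences outside `T`, even empty. The
    -- maximal choice is `sweep`.
    record Move (x y : Vec ℕ n) : Set where
      constructor move
      field
        {U} : Subset n
        U⊆  : U ⊆ Em q x
        U∩T : ∀ {i} → i ∈ U → i ∉ T
        eq  : change p U x ≡ y

    sweep : Vec ℕ n → Vec ℕ n
    sweep x = change p (Em q x ─ T) x

    -- If nothing is left to change, the sweep is the identity and the given run already starts at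
    -- `x`.
    Iterate-sweep⁺ : ∀ {x η} → Iterate p q T (sweep x) η → Iterate p q T x η
    Iterate-sweep⁺ {x} {η} l with nonempty? (Em q x ─ T)
    ... | yes s     = repeat s l
    ... | no  empty = subst (λ y → Iterate p q T y η) (change-empty p x empty) l

    -- The moves still possible after a partial sweep include the rest of that
    -- sweep, hence both sides meet again after one more sweep.
    module _ {x y} (m : Move x y) where
      open Move m
      private
        W = Em q x ─ T
        V = W ─ U
        W′ = Em q y ─ T

        U⊆W : U ⊆ W
        U⊆W i∈ = x∈p∧x∉q⇒x∈p─q (U⊆ i∈) (U∩T i∈)

        V⊆W′ : V ⊆ W′
        V⊆W′ {i} i∈ = x∈p∧x∉q⇒x∈p─q
          (subst (λ z → i ∈ Em q z) eq
            (change-keeps comp x U⊆ (p─q⊆p _ T (p─q⊆p W U i∈)) (x∈p─q⇒x∉q W U i∈)))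
          (x∈p─q⇒x∉q (Em q x) T (p─q⊆p W U i∈))

        V⊆y : V ⊆ Em q y
        V⊆y = p─q⊆p _ T ∘ V⊆W′

      catch-up : change p V y ≡ sweep x
      catch-up = trans (cong (change p V) (sym eq)) (change-rest x U⊆W (p─q⊆p _ T))

      sweep-Move : Move (sweep x) (sweep y)
      sweep-Move = move {U = W′ ─ V}
        (λ {i} i∈ → subst (λ z → i ∈ Em q z) catch-up
          (change-keeps comp y V⊆y (p─q⊆p _ T (p─q⊆p W′ V i∈)) (x∈p─q⇒x∉q W′ V i∈)))
        (x∈p─q⇒x∉q (Em q y) T ∘ p─q⊆p W′ V)
        (trans (cong (change p (W′ ─ V)) (sym catch-up)) (change-rest y V⊆W′ (p─q⊆p _ T)))

      Move-of-stopped : Empty W → x ≡ y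
      Move-of-stopped empty = trans (sym (change-empty p x (λ (i , i∈) → empty (i , U⊆W i∈)))) eq

      -- The rest `V` of the sweep consists of changes still possible in `y`, so it is empty and the
      -- move was the whole sweep.
      Move-to-stopped : Empty W′ → sweep x ≡ y
      Move-to-stopped empty =
        trans (sym catch-up) (change-empty p y (λ (i , i∈) → empty (i , V⊆W′ i∈)))

    -- Induction on the given run: sweeping both words yields words again joined by a move. The
    -- other word's run is built along the way, at most one sweep out of step.
    Iterate-Move⁺ : ∀ {x y η} → Move x y → Iterate p q T x η → Iterate p q T y η
    Iterate-Move⁺ m (stop e)     =
      subst (λ z → Iterate p q T z _) (Move-of-stopped m e) (stop e)
    Iterate-Move⁺ m (repeat _ l) = Iterate-sweep⁺ (Iterate-Move⁺ (sweep-Move m) l)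

    Iterate-Move⁻ : ∀ {x y η} → Move x y → Iterate p q T y η → Iterate p q T x η
    Iterate-Move⁻ m (stop e)     = Iterate-sweep⁺
      (subst (λ z → Iterate p q T z _) (sym (Move-to-stopped m e)) (stop e))
    Iterate-Move⁻ m (repeat _ l) = Iterate-sweep⁺ (Iterate-Move⁻ (sweep-Move m) l)

-- Exchanging the two patterns.

module _ {p q : Pattern} where

  StandingAssumptions-sym : StandingAssumptions p q → StandingAssumptions q p
  StandingAssumptions-sym sa = record
    { p-nonOverlapping = q-nonOverlapping
    ; q-nonOverlapping = p-nonOverlapping
    ; sameFirst        = sym sameFirst
    ; sameLast         = sym sameLast
    ; d                = d
    ; p-entries        = q-entries
    ; q-entries        = p-entries
    ; p→q-inversion    = q→p-inversion
    ; q→p-inversion    = p→q-inversion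
    ; φ≥-to            = φ≥-from
    ; φ≥-from          = φ≥-to
    ; φ≥-inverseˡ      = φ≥-inverseʳ
    ; φ≥-inverseʳ      = φ≥-inverseˡ
    }
    where open StandingAssumptions sa

  compatible : StandingAssumptions p q → Compatible p q
  compatible sa = record
    { nonOverlapping = q-nonOverlapping
    ; sameFirst      = trans (nth-first p) (trans sameFirst (sym (nth-first q)))
    ; sameLast       = trans (nth-last p) (trans sameLast (sym (nth-last q)))
    }
    where open StandingAssumptions sa

module _ {n : ℕ} {p q : Pattern} where
  mutual

    -- With `p` and `q` exchanged, the graph of `φ=` becomes that of `ψ=`, so a result proved for
    -- `φ=` and all pairs of patterns also serves for `ψ=`.
    φ=⇒ψ= : ∀ {T : Subset n} {x y} → φ= q p T x y → ψ= p q T x y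
    φ=⇒ψ= (start l) = start (φ-Loop⇒ψ-Loop l)

    φ-Loop⇒ψ-Loop : ∀ {T : Subset n} {x y} → φ-Loop q p T x y → ψ-Loop p q T x y
    φ-Loop⇒ψ-Loop (stop e)       = stop e
    φ-Loop⇒ψ-Loop (repeat e s l) = repeat e (ψ=⇒φ= s) (φ-Loop⇒ψ-Loop l)

    ψ=⇒φ= : ∀ {T : Subset n} {x y} → ψ= q p T x y → φ= p q T x y
    ψ=⇒φ= (start l) = start (ψ-Loop⇒φ-Loop l)

    ψ-Loop⇒φ-Loop : ∀ {T : Subset n} {x y} → ψ-Loop q p T x y → φ-Loop p q T x y
    ψ-Loop⇒φ-Loop (stop e)       = stop e
    ψ-Loop⇒φ-Loop (repeat e s l) = repeat e (φ=⇒ψ= s) (ψ-Loop⇒φ-Loop l)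

-- The reversed procedure and the rounds of the loop of `φ=`.

module _ {p q : Pattern} (sa : StandingAssumptions p q) {n : ℕ} where
  open StandingAssumptions sa

  private
    cpq = compatible sa
    cqp = compatible (StandingAssumptions-sym sa)

  -- The changes at `T` and `V` commute, so the left word is the right one with `V` changed to `q`;
  -- changing `V` back to `p` is a move.
  reverse-Move : ∀ {T V : Subset n} {x} → Inversion x → T ⊆ Em p x → V ⊆ Em p x →
    (∀ {i} → i ∈ V → i ∉ T) → Move cpq T (change q T (change q V x)) (change q T x)
  reverse-Move {T} {V} {x} inv T⊆ V⊆ V∩T =
    subst (λ z′ → Move cpq T z′ z) (change-comm cqp x T⊆ V⊆ V∩T)
      (move (proj₂ (φ≥-to V z z∈)) V∩T (φ≥-inverseˡ V z z∈))
    where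
    z = change q T x
    z∈ : I⊇ p V z
    z∈ = proj₁ (φ≥-to T x (inv , T⊆)) , λ i∈ → change-keeps cqp x T⊆ (V⊆ i∈) (V∩T i∈)

  module _ {S T : Subset n} (T⊆S : T ⊆ S) where

    private
      module Round {x} (inv : Inversion x) (T⊆ : T ⊆ Em p x) where
        V = Em p x ─ S
        V∩T : ∀ {i} → i ∈ V → i ∉ T
        V∩T i∈ i∈T = x∈p─q⇒x∉q (Em p x) S i∈ (T⊆S i∈T)
        inv′ : Inversion (change q V x)
        inv′ = proj₁ (φ≥-to V x (inv , p─q⊆p _ S))
        T⊆′ : T ⊆ Em p (change q V x)
        T⊆′ i∈ = change-keeps cqp x (p─q⊆p _ S) (T⊆ i∈) (λ i∈V → V∩T i∈V i∈)
        back : Move cpq T (change q T (change q V x)) (change q T x)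
        back = reverse-Move inv T⊆ (p─q⊆p _ S) V∩T

    -- A run of the reversed procedure for `S` never touches `T`, as `T ⊆ S`. After `T` is changed
    -- to `q`, each of its rounds is a move read backwards, and moves keep the outcome.
    transport⁺ : ∀ {x y η} → Inversion x → T ⊆ Em p x → Iterate q p S x y →
      Iterate p q T (change q T x) η → Iterate p q T (change q T y) η
    transport⁺ inv T⊆ (stop _)     = id
    transport⁺ inv T⊆ (repeat _ r) = transport⁺ inv′ T⊆′ r ∘ Iterate-Move⁻ cpq T back
      where open Round inv T⊆

    transport⁻ : ∀ {x y η} → Inversion x → T ⊆ Em p x → Iterate q p S x y →
      Iterate p q T (change q T y) η → Iterate p q T (change q T x) η
    transport⁻ inv T⊆ (stop _)     = id
    transport⁻ inv T⊆ (repeat _ r) = Iterate-Move⁺ cpq T back ∘ transport⁻ inv′ T⊆′ r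
      where open Round inv T⊆

  -- Transport along the reversed run, with `S` in place of `T`: changing `S` to `p` and back gives
  -- `y`, where the procedure stops at once.
  Iterate-inverse : ∀ {S : Subset n} {y x} → Inversion y → Em q y ≡ S →
    Iterate q p S (change p S y) x → Iterate p q S (change q S x) y
  Iterate-inverse {y = y} inv refl r =
    let (inv′ , ⊆′) = φ≥-from (Em q y) y (inv , id) in
    transport⁺ id inv′ ⊆′ r
      (subst (λ z → Iterate p q (Em q y) z y) (sym (φ≥-inverseʳ (Em q y) y (inv , id)))
        (stop λ (i , i∈) → x∈p─q⇒x∉q (Em q y) (Em q y) i∈ (p─q⊆p _ (Em q y) i∈)))

  -- One round of the loop of `φ=`. It keeps both the derivation of `ψ=` and the equivalent reversed
  -- run, to rebuild the loop and the procedure respectively.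
  record Step (T : Subset n) (x y : Vec ℕ n) : Set where
    constructor step
    field
      {ε′}  : Vec ℕ n
      x-inv : Inversion x
      T⊆    : T ⊆ Em q x
      more  : Em q x ≢ T
      ψ     : ψ= p q (Em q x) x ε′
      run   : Iterate q p (Em q x) (change p (Em q x) x) ε′
      ε′∈   : I= p (Em q x) ε′
      eq    : change q T ε′ ≡ y

    T⊆ε′ : T ⊆ Em p ε′
    T⊆ε′ = subst (T ⊆_) (sym (proj₂ ε′∈)) T⊆

    undo : change p T y ≡ ε′
    undo = trans (cong (change p T) (sym eq)) (φ≥-inverseˡ T ε′ (proj₁ ε′∈ , T⊆ε′))

  -- From `y`, changing `T` back recovers `ε′`; its occurrences of `p` recover `Em q x`; and the
  -- forward procedure for that set recovers `x`.
  Step-injective : ∀ {T x x′ y} → Step T x y → Step T x′ y → x ≡ x′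
  Step-injective {x = x} {x′} s s′ = Iterate-functional
    (Iterate-inverse S.x-inv refl S.run)
    (subst₂ (λ S ε → Iterate p q S (change q S ε) x′) S′≡S (sym ε≡)
      (Iterate-inverse S′.x-inv refl S′.run))
    where
    module S = Step s
    module S′ = Step s′
    ε≡ : S.ε′ ≡ S′.ε′
    ε≡ = trans (sym S.undo) S′.undo
    S′≡S : Em q x′ ≡ Em q x
    S′≡S = trans (sym (proj₂ S′.ε′∈)) (trans (cong (Em p) (sym ε≡)) (proj₂ S.ε′∈))

  -- The intermediate word of such a step would be `ε`, whose occurrences of `p` are exactly `T`,
  -- whereas a step passes through a different set.
  Step-start : ∀ {T x ε} → Inversion ε → Em p ε ≡ T → ¬ Step T x (change q T ε)
  Step-start {ε = ε} inv refl s = more (trans (sym (proj₂ ε′∈))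
    (cong (Em p) (trans (sym undo) (φ≥-inverseˡ _ ε (inv , id)))))
    where open Step s

  -- Transporting back along the reversed run leads from `y` to a word that equals `sweep x`.
  Step-Iterate : ∀ {T x y η} → Step T x y → Iterate p q T y η → Iterate p q T x η
  Step-Iterate {T} {x} {y} {η} s l = Iterate-sweep⁺ cpq T
    (subst (λ z → Iterate p q T z η) returns
      (transport⁻ T⊆ inv′ (⊆′ ∘ T⊆) run (subst (λ z → Iterate p q T z η) (sym eq) l)))
    where
    open Step s
    inv′ = proj₁ (φ≥-from (Em q x) x (x-inv , id))
    ⊆′ = proj₂ (φ≥-from (Em q x) x (x-inv , id))
    swept = sweep cpq T x
    swept-inv : Inversion swept
    swept-inv = proj₁ (φ≥-from (Em q x ─ T) x (x-inv , p─q⊆p _ T))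
    swept⊇ : T ⊆ Em q swept
    swept⊇ i∈ = change-keeps cpq x (p─q⊆p _ T) (T⊆ i∈) (λ i∈V → x∈p─q⇒x∉q (Em q x) T i∈V i∈)
    -- Of the changes at `Em q x`, those at `T` can be made last, and changing them to `q` again
    -- cancels them.
    returns : change q T (change p (Em q x) x) ≡ swept
    returns = begin
      change q T (change p (Em q x) x)
        ≡⟨ cong (change q T) (change-rest cpq x T⊆ id) ⟨
      change q T (change p (Em q x ─ T) (change p T x))
        ≡⟨ cong (change q T) (change-comm cpq x T⊆ (p─q⊆p _ T) (x∈p─q⇒x∉q (Em q x) T)) ⟩
      change q T (change p T swept)
        ≡⟨ φ≥-inverseʳ T swept (swept-inv , swept⊇) ⟩
      swept ∎
      where open ≡-Reasoning

-- An orbit of an injective relation on a finite set that starts outside the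
-- range cannot revisit a point, so it reaches a point without successor.
module Orbit {A : Set} {G : A → Set} {_⟶_ : A → A → Set} {N : ℕ}
  (code : ∀ {x} → G x → Fin N)
  (code-injective : ∀ {x y} (g : G x) (h : G y) → code g ≡ code h → x ≡ y)
  (injective : ∀ {x y z} → x ⟶ z → y ⟶ z → x ≡ y)
  {x₀ : A} (g₀ : G x₀) (outside-range : ∀ {x} → ¬ x ⟶ x₀) where

  data Path : ℕ → A → Set where
    []  : Path 0 x₀
    _▷_ : ∀ {k x y} → Path k x → (x ⟶ y) × G y → Path (suc k) y

  good : ∀ {k x} → Path k x → G x
  good []            = g₀
  good (_ ▷ (_ , g)) = g

  prefix : ∀ {j k x} → j ≤ k → Path k x → ∃[ y ] Path j y
  prefix j≤k π with m≤n⇒m<n∨m≡n j≤k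
  prefix j≤k π       | inj₂ refl = _ , π
  prefix j≤k (π ▷ _) | inj₁ j<k  = prefix (≤-pred j<k) π

  -- Injectivity lets both paths be retraced in step; the shorter one reaches `x₀` first and gives
  -- it a predecessor.
  no-return : ∀ {j k x} → Path j x → Path k x → ¬ j < k
  no-return []            (_ ▷ (s , _))  _   = outside-range s
  no-return (π ▷ (s , _)) (π′ ▷ (s′ , _)) j<k with refl ← injective s s′ =
    no-return π π′ (≤-pred j<k)

  bounded : ∀ {x} → ¬ Path N x
  bounded π = no-return (node i) (subst (Path (toℕ j)) (sym x≡) (node j)) i<j
    where
    path : (i : Fin (suc N)) → ∃[ y ] Path (toℕ i) y
    path i = prefix (≤-pred (toℕ<n i)) π
    node : (i : Fin (suc N)) → Path (toℕ i) (proj₁ (path i))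
    node i = proj₂ (path i)
    -- A path of `N` steps has `N + 1` points.
    collision = pigeonhole (n<1+n N) (λ i → code (good (node i)))
    i = proj₁ collision
    j = proj₁ (proj₂ collision)
    i<j = proj₁ (proj₂ (proj₂ collision))
    x≡ : proj₁ (path i) ≡ proj₁ (path j)
    x≡ = code-injective (good (node i)) (good (node j)) (proj₂ (proj₂ (proj₂ collision)))

  module _ {Stop : A → Set} (progress : ∀ {x} → G x → Stop x ⊎ ∃[ y ] ((x ⟶ y) × G y)) where

    run : ∀ k → (∃[ x ] (G x × Stop x × ∃[ j ] Path j x)) ⊎ ∃[ x ] Path k x
    run zero    = inj₂ (x₀ , [])
    run (suc k) with run k
    ... | inj₁ done    = inj₁ done
    ... | inj₂ (x , π) with progress (good π)
    ... | inj₁ s       = inj₁ (x , good π , s , k , π)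
    ... | inj₂ (y , s) = inj₂ (y , π ▷ s)

    stops : ∃[ x ] (G x × Stop x × ∃[ j ] Path j x)
    stops with run N
    ... | inj₁ done    = done
    ... | inj₂ (_ , π) = contradiction π bounded

  unwind : {P : A → Set} → (∀ {x y} → x ⟶ y → P y → P x) → ∀ {k x} → Path k x → P x → P x₀
  unwind back []            = id
  unwind back (π ▷ (s , _)) = unwind back π ∘ back s

-- Finiteness of `I_n`, and the induction on `T`.

code : ∀ {n} {ε : Vec ℕ n} → Inversion ε → Fin (n ^ n)
-- All entries are below `n`, so the word is one of the `n ^ n` self-maps of `Fin n`.
code inv = funToFin λ i → fromℕ< (≤-<-trans (inv i) (toℕ<n i))

code-injective : ∀ {n} {ε η : Vec ℕ n} (inv : Inversion ε) (inv′ : Inversion η) →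
  code {ε = ε} inv ≡ code {ε = η} inv′ → ε ≡ η
code-injective {n} {ε} {η} inv inv′ e = lookup-injective λ i →
  fromℕ<-injective _ _ _ _ (trans (sym (finToFun-funToFin _ i))
    (trans (cong (λ c → finToFun {n} {n} c i) e) (finToFun-funToFin _ i)))
  where
  lookup-injective : ∀ {m} {x y : Vec ℕ m} → (∀ i → lookup x i ≡ lookup y i) → x ≡ y
  lookup-injective {x = []}    {[]}    _ = refl
  lookup-injective {x = _ ∷ _} {_ ∷ _} h = cong₂ _∷_ (h zero) (lookup-injective (h ∘ suc))

-- Induction on `T` towards larger sets. The patterns are quantified after the accessibility proof,
-- so the hypothesis also holds with their roles exchanged.
procedure-computes-φ= : ∀ {n} {T : Subset n} → Acc _⊃_ T → ∀ {p q} → StandingAssumptions p q →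
  ∀ (ε : Vec ℕ n) → I= p T ε →
  ∃[ η ] (Iterate p q T (change q T ε) η × I= q T η × φ= p q T ε η)
procedure-computes-φ= {n} {T} (acc rec) {p} {q} sa ε (inv , Em≡T) = result
  where
  open StandingAssumptions sa

  G : Vec ℕ n → Set
  G = I⊇ q T

  progress : ∀ {x} → G x → Em q x ≡ T ⊎ ∃[ y ] (Step sa T x y × G y)
  progress {x} (x-inv , T⊆) with ≡-dec Bool._≟_ (Em q x) T
  ... | yes e = inj₁ e
  ... | no ne =
    let ε′ , r , ε′∈@(inv′ , Em≡) , φ =
          procedure-computes-φ= (rec (⊆∧≢⇒⊂ T⊆ ne)) (StandingAssumptions-sym sa) x (x-inv , refl)
    in inj₂ (change q T ε′ , step x-inv T⊆ ne (φ=⇒ψ= φ) r ε′∈ refl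
            , φ≥-to T ε′ (inv′ , subst (T ⊆_) (sym Em≡) T⊆))

  open Orbit {G = G} {_⟶_ = Step sa T}
    (λ {x} g → code {ε = x} (proj₁ g))
    (λ {x} {y} g h → code-injective {ε = x} {y} (proj₁ g) (proj₁ h))
    (Step-injective sa)
    (φ≥-to T ε (inv , subst (T ⊆_) (sym Em≡T) id))
    (Step-start sa inv Em≡T)

  result : ∃[ η ] (Iterate p q T (change q T ε) η × I= q T η × φ= p q T ε η)
  result with η , (η-inv , _) , e , _ , π ← stops progress = η
    , unwind {P = λ x → Iterate p q T x η} (Step-Iterate sa) π
        (stop λ (i , i∈) → x∈p─q⇒x∉q (Em q η) T i∈ (subst (i ∈_) e (p─q⊆p _ T i∈)))
    , (η-inv , e)
    -- The same path rebuilds the derivation of the loop, one `repeat` for each step.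
    , start (unwind {P = λ x → φ-Loop p q T x η}
        (λ s l → let open Step s in repeat more ψ (subst (λ y → φ-Loop p q T y η) (sym eq) l))
        π (stop e))

theorem2 : (p q : Pattern) → StandingAssumptions p q →
    (n : ℕ) (ε : Vec ℕ n) → Inversion ε →
    ∃[ ε′ ] (Procedure p q ε ε′ × I= q (Em p ε) ε′ × φ= p q (Em p ε) ε ε′)
theorem2 p q sa n ε inv = procedure-computes-φ= (⊃-wellFounded (Em p ε)) sa ε (inv , refl)
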